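{- Let $E_e$ be the edge vectors on the plabic network $(\mathcal N,\mathcal O,\mathfrak l)$. (1) Let $u$ be a trivalent white vertex with incoming edge $e_3$ and outgoing edges $e_1,e_2$, let $t_u>0$, and let $\tilde{\mathcal N}$ be obtained from $\mathcal N$ by the weight gauge transformation at $u$: $\tilde w_{e_1}=t_uw_{e_1}$, $\tilde w_{e_2}=t_uw_{e_2}$, $\tilde w_{e_3}=t_u^{ -1}w_{e_3}$, all other weights unchanged. Then the edge vectors $\tilde E_e$ of $(\tilde{\mathcal N},\mathcal O,\mathfrak l)$ are $$\tilde E_e=\begin{cases}E_e & e\neq e_1,e_2,\\ t_uE_e & e=e_1,e_2.\end{cases}$$ (2) Let $v$ be a trivalent black vertex with incoming edges $e_2,e_3$ and outgoing edge $e_1$, let $t_v>0$, and let $\tilde{\mathcal N}$ be obtained from $\mathcal N$ by the weight gauge transformation at $v$: $\tilde w_{e_1}=t_vw_{e_1}$, $\tilde w_{e_2}=t_v^{ -1}w_{e_2}$, $\tilde w_{e_3}=t_v^{ -1}w_{e_3}$, all other weights unchanged. Then the edge vectors $\tilde E_e$ of $(\tilde{\mathcal N},\mathcal O,\mathfrak l)$ are $$\tilde E_e=\begin{cases}E_e & e\neq e_1,\\ t_vE_e & e=e_1.\end{cases}$$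
   Context: **Plabic networks.** Let $D$ be a closed convex disk whose boundary contains a straight segment. A plabic graph is a finite directed planar graph embedded in $D$ with straight edges. It has boundary vertices $b_1,\dots,b_n$ on the segment, labelled clockwise, each of degree 1 (a source if its edge is outgoing, a sink otherwise). The remaining (internal) vertices lie inside $D$ and have degree 2 or 3. No component is isolated from the boundary. The graph is perfect: each internal vertex has exactly one incoming edge (then it is white) or exactly one outgoing edge (then it is black); bivalent vertices have one incoming and one outgoing edge and either color. The orientation $\mathcal O$ is called a perfect orientation. A network $\mathcal N$ has a positive weight $w_e$ on each directed edge. **Gauge rays.** A gauge ray direction $\mathfrak l$ is an oriented direction, not parallel to any edge, such that the rays with direction $\mathfrak l$ starting at boundary vertices point inside $D$ and contain no internal vertices. The gauge rays are those starting at the boundary sources, and $\mathrm{int}(e)$ is the number of their intersections with $e$ (base points not counted). **Winding.** $s(a,b)=+1,0,-1$ if the ordered pair $(a,b)$ is positively oriented, parallel, negatively oriented. For consecutive directed edges: $\mathrm{wind}(e,f)=\pm1$ if $s(e,f)=s(e,\mathfrak l)=s(\mathfrak l,f)=\pm1$; otherwise $0$. **Edge vectors.** The edge vectors are the unique solution of $E_e=(-1)^{\mathrm{int}(e)}w_e\sum_f(-1)^{\mathrm{wind}(e,f)}E_f$ (for every edge $e$ ending at an internal vertex $V$, $f$ running over the edges outgoing at $V$), with $E_{e_j}=(-1)^{\mathrm{int}(e_j)}w_{e_j}E_j$ at the edge $e_j$ ending at the sink $b_j$, $E_j$ being the $j$-th canonical basis vector of $\mathbb R^n$. **Weight gauge.**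 In general, the weight gauge transformation with positive numbers $t_V$ at internal vertices ($t_{b_i}=1$) is $w_e\mapsto w_et_Ut_V^{ -1}$ for $e=(U,V)$ directed from $U$ to $V$. -}

module Defs where

open import Algebra.Bundles using (CommutativeRing)
import Algebra.Properties.Ring as RingProperties
import Algebra.Properties.Semiring.Exp as Exp
open import Data.Bool.Base using (if_then_else_; _∧_)
open import Data.Empty using (⊥-elim)
open import Data.Fin.Base as Fin using (Fin)
import Data.Fin.Properties as Fin
open import Data.Integer.Base as ℤ using (ℤ; 0ℤ; 1ℤ; -1ℤ)
import Data.Integer.Properties as ℤ
open import Data.List.Base using (List; allFin; filter; foldr; length; map)
open import Data.Nat.Base as ℕ using (ℕ)
open import Data.Product.Base using (∃; ∃-syntax; _×_; _,_; proj₁; proj₂)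
open import Data.Sum.Base using (_⊎_; inj₁; inj₂)
import Data.Sum.Properties as Sum
open import Level using (0ℓ)
open import Relation.Binary.Construct.Closure.Equivalence using (EqClosure)
import Relation.Binary.Construct.StrictToNonStrict as StrictToNonStrict
import Relation.Binary.Reasoning.Setoid as SetoidReasoning
open import Relation.Binary.Core using (Rel)
open import Relation.Binary.Definitions using (DecidableEquality; tri<; tri≈; tri>)
open import Relation.Binary.PropositionalEquality.Core using (_≡_; _≢_)
open import Relation.Binary.Structures using (IsStrictTotalOrder)
open import Relation.Nullary using (¬_; Dec; yes; no)
open import Relation.Nullary.Decidable using (⌊_⌋; _×-dec_)

-- The library has no real numbers, so they are axiomatised: a Reals is a
-- Dedekind-complete ordered field with the (classical) trichotomous order, which
-- determines it up to isomorphism.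
record Reals : Set₁ where
  infix 4 _<_
  field
    commutativeRing : CommutativeRing 0ℓ 0ℓ
  open CommutativeRing commutativeRing public
  field
    _<_                : Rel Carrier 0ℓ
    isStrictTotalOrder : IsStrictTotalOrder _≈_ _<_
    +-monoˡ-<          : ∀ z {x y} → x < y → x + z < y + z
    *-pos              : ∀ {x y} → 0# < x → 0# < y → 0# < x * y
    0<1                : 0# < 1#
    inverse            : ∀ x → ¬ x ≈ 0# → ∃[ y ] x * y ≈ 1#

  open StrictToNonStrict _≈_ _<_ public using (_≤_)

  UpperBound : (Carrier → Set) → Carrier → Set
  UpperBound P b = ∀ x → P x → x ≤ b

  field
    supremum : ∀ (P : Carrier → Set) → ∃ P → ∃ (UpperBound P) →
               ∃[ s ] UpperBound P s × (∀ b → UpperBound P b → s ≤ b)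

data Colour : Set where
  white black : Colour

module Plabic (ℝ : Reals) where
  open Reals ℝ public
  open Exp semiring public using (_^_)
  open RingProperties ring
    using (-‿distribˡ-*; -‿distribʳ-*; -‿involutive; -‿+-comm; -0#≈0#)
  private
    module O = IsStrictTotalOrder isStrictTotalOrder
    module R = SetoidReasoning setoid

  record ℝ⁺ : Set where
    constructor _,⁺_
    field
      val      : Carrier
      positive : 0# < val
  open ℝ⁺ public

  private
    pos⇒≉0 : ∀ {x} → 0# < x → ¬ x ≈ 0#
    pos⇒≉0 0<x x≈0 = O.irrefl (sym x≈0) 0<x

    neg-pos : ∀ {x} → x < 0# → 0# < - x
    neg-pos {x} x<0 =
      O.<-respˡ-≈ (-‿inverseʳ x) (O.<-respʳ-≈ (+-identityˡ (- x)) (+-monoˡ-< (- x) x<0))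

    inverse-pos : ∀ {x y} → 0# < x → x * y ≈ 1# → 0# < y
    inverse-pos {x} {y} 0<x xy≈1 with O.compare 0# y
    ... | tri< 0<y _ _ = 0<y
    ... | tri≈ _ 0≈y _ = ⊥-elim (pos⇒≉0 0<1
            (trans (sym xy≈1) (trans (*-congˡ (sym 0≈y)) (zeroʳ x))))
    ... | tri> _ _ y<0 = ⊥-elim (O.irrefl refl (O.trans 0<1 1<0))
      where
      0<-1 : 0# < - 1#
      0<-1 = O.<-respʳ-≈ (trans (sym (-‿distribʳ-* x y)) (-‿cong xy≈1))
                         (*-pos 0<x (neg-pos y<0))
      1<0 : 1# < 0#
      1<0 = O.<-respˡ-≈ (+-identityˡ 1#)
              (O.<-respʳ-≈ (-‿inverseˡ 1#) (+-monoˡ-< 1# 0<-1))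

  infixl 7 _*⁺_
  infix  8 _⁻¹

  1⁺ : ℝ⁺
  1⁺ = 1# ,⁺ 0<1

  _*⁺_ : ℝ⁺ → ℝ⁺ → ℝ⁺
  (x ,⁺ 0<x) *⁺ (y ,⁺ 0<y) = (x * y) ,⁺ *-pos 0<x 0<y

  _⁻¹ : ℝ⁺ → ℝ⁺
  (x ,⁺ 0<x) ⁻¹ with y , xy≈1 ← inverse x (pos⇒≉0 0<x) = y ,⁺ inverse-pos 0<x xy≈1

  ----------------------------------------------------------------------
  -- The oriented plane

  Point : Set
  Point = Carrier × Carrier

  infix  4 _≈ₚ_
  infixl 6 _+ₚ_ _-ₚ_
  infixr 7 _·ₚ_

  _≈ₚ_ : Rel Point 0ℓ
  (x , y) ≈ₚ (x′ , y′) = x ≈ x′ × y ≈ y′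

  _+ₚ_ _-ₚ_ : Point → Point → Point
  (x , y) +ₚ (x′ , y′) = x + x′ , y + y′
  (x , y) -ₚ (x′ , y′) = x - x′ , y - y′

  _·ₚ_ : Carrier → Point → Point
  r ·ₚ (x , y) = r * x , r * y

  0ₚ : Point
  0ₚ = 0# , 0#

  det : Point → Point → Carrier
  det (x , y) (x′ , y′) = x * y′ - y * x′

  dist² : Point → Point → Carrier
  dist² (x , y) (x′ , y′) = (x - x′) * (x - x′) + (y - y′) * (y - y′)

  sgn : Carrier → ℤ
  sgn x with O.compare x 0#
  ... | tri< _ _ _ = -1ℤ
  ... | tri≈ _ _ _ = 0ℤ
  ... | tri> _ _ _ = 1ℤ

  s : Point → Point → ℤ
  s a b = sgn (det a b)

  Parallel : Point → Point → Set
  Parallel a b = s a b ≡ 0ℤ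

  OnSegment : Point → Point → Point → Set
  OnSegment A B p = ∃[ r ] 0# ≤ r × r ≤ 1# × p ≈ₚ A +ₚ r ·ₚ (B -ₚ A)

  Interior : (Point → Set) → Point → Set
  Interior D p = ∃[ r ] 0# < r × (∀ q → dist² p q < r * r → D q)

  record IsClosedConvexDisk (D : Point → Set) : Set where
    field
      respects : ∀ {p q} → p ≈ₚ q → D p → D q
      convex   : ∀ {p q x} → D p → D q → OnSegment p q x → D x
      closed   : ∀ p → ¬ D p → Interior (λ q → ¬ D q) p
      bounded  : ∃[ M ] (∀ p → D p → dist² 0ₚ p < M)
      solid    : ∃[ p ] Interior D p

  -- For a closed set this is the topological boundary.
  Boundary : (Point → Set) → Point → Set
  Boundary D p = D p × ¬ Interior D p

  ----------------------------------------------------------------------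
  -- Plabic graphs

  -- Directed graphs on the boundary vertices inj₁ i and internal vertices inj₂ u.
  record Digraph (n : ℕ) : Set where
    field
      internals edges : ℕ

    Internal : Set
    Internal = Fin internals

    Edge : Set
    Edge = Fin edges

    Vertex : Set
    Vertex = Fin n ⊎ Internal

    field
      src tgt : Edge → Vertex

    _≟ᵥ_ : DecidableEquality Vertex
    _≟ᵥ_ = Sum.≡-dec Fin._≟_ Fin._≟_

    outgoing incoming : Vertex → List Edge
    outgoing v = filter (λ e → src e ≟ᵥ v) (allFin edges)
    incoming v = filter (λ e → tgt e ≟ᵥ v) (allFin edges)

    degree : Vertex → ℕ
    degree v = length (outgoing v) ℕ.+ length (incoming v)

    Adjacent : Rel Vertex 0ℓ
    Adjacent u v = ∃[ e ] src e ≡ u × tgt e ≡ v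

    Endpoint : Edge → Vertex → Set
    Endpoint e v = src e ≡ v ⊎ tgt e ≡ v

    Source : Fin n → Set
    Source i = ∃[ e ] src e ≡ inj₁ i

    source? : ∀ i → Dec (Source i)
    source? i = Fin.any? (λ e → src e ≟ᵥ inj₁ i)

  record PlabicGraph (n : ℕ) : Set₁ where
    field
      digraph : Digraph n
    open Digraph digraph public

    field
      disk             : Point → Set
      isDisk           : IsClosedConvexDisk disk
      A B              : Point
      A≉B              : ¬ A ≈ₚ B
      segment⊆boundary : ∀ p → OnSegment A B p → Boundary disk p

      pos              : Vertex → Point
      boundary-pos     : ∀ i → OnSegment A B (pos (inj₁ i))
      -- Walking clockwise along the boundary keeps the disk on the right.
      clockwise        : ∀ {i j} → i Fin.< j → ∀ p → Interior disk p →
                         s (pos (inj₁ j) -ₚ pos (inj₁ i)) (p -ₚ pos (inj₁ i)) ≡ -1ℤ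
      internal-pos     : ∀ u → Interior disk (pos (inj₂ u))

    OnEdge : Edge → Point → Set
    OnEdge e = OnSegment (pos (src e)) (pos (tgt e))

    -- Planar embedding by straight edges; by convexity these stay inside the disk.
    field
      pos-injective    : ∀ {u v} → pos u ≈ₚ pos v → u ≡ v
      no-loops         : ∀ e → src e ≢ tgt e
      vertex-on-edge   : ∀ e v → OnEdge e (pos v) → Endpoint e v
      no-crossings     : ∀ {e f} → e ≢ f → ∀ p → OnEdge e p → OnEdge f p →
                         ∃[ v ] Endpoint e v × Endpoint f v × p ≈ₚ pos v

      boundary-degree  : ∀ i → degree (inj₁ i) ≡ 1
      internal-degree  : ∀ u → degree (inj₂ u) ≡ 2 ⊎ degree (inj₂ u) ≡ 3
      not-isolated     : ∀ u → ∃[ i ] EqClosure Adjacent (inj₂ u) (inj₁ i)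

      colour           : Internal → Colour
      white-perfect    : ∀ u → colour u ≡ white → length (incoming (inj₂ u)) ≡ 1
      black-perfect    : ∀ u → colour u ≡ black → length (outgoing (inj₂ u)) ≡ 1

    dir : Edge → Point
    dir e = pos (tgt e) -ₚ pos (src e)

  record GaugeDirection {n} (G : PlabicGraph n) : Set where
    open PlabicGraph G
    field
      𝔩            : Point
      nonzero      : ¬ 𝔩 ≈ₚ 0ₚ
      not-parallel : ∀ e → ¬ Parallel 𝔩 (dir e)
      inwards      : ∀ i → ∃[ ε ] 0# < ε ×
                     (∀ t → 0# < t → t < ε → Interior disk (pos (inj₁ i) +ₚ t ·ₚ 𝔩))
      no-internal  : ∀ i u t → 0# ≤ t → ¬ pos (inj₂ u) ≈ₚ pos (inj₁ i) +ₚ t ·ₚ 𝔩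

  -- The open ray from b in direction l meets the segment [U,V].
  RayMeets : (b l U V : Point) → Set
  RayMeets b l U V = ∃[ t ] 0# < t × OnSegment U V (b +ₚ t ·ₚ l)

  private
    det-+ : ∀ a b c → det (a +ₚ b) c ≈ det a c + det b c
    det-+ (a , a′) (b , b′) (c , c′) = begin
      (a + b) * c′ - (a′ + b′) * c                ≈⟨ +-cong (distribʳ c′ a b) (-‿cong (distribʳ c a′ b′)) ⟩
      (a * c′ + b * c′) - (a′ * c + b′ * c)       ≈⟨ +-congˡ (-‿+-comm _ _) ⟨
      (a * c′ + b * c′) + (- (a′ * c) - b′ * c)   ≈⟨ +-assoc _ _ _ ⟩
      a * c′ + (b * c′ + (- (a′ * c) - b′ * c))   ≈⟨ +-congˡ (+-assoc _ _ _) ⟨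
      a * c′ + ((b * c′ - a′ * c) - b′ * c)       ≈⟨ +-congˡ (+-congʳ (+-comm _ _)) ⟩
      a * c′ + ((- (a′ * c) + b * c′) - b′ * c)   ≈⟨ +-congˡ (+-assoc _ _ _) ⟩
      a * c′ + (- (a′ * c) + (b * c′ - b′ * c))   ≈⟨ +-assoc _ _ _ ⟨
      (a * c′ - a′ * c) + (b * c′ - b′ * c)       ∎
      where open R

    det-· : ∀ r a c → det (r ·ₚ a) c ≈ r * det a c
    det-· r (a , a′) (c , c′) = begin
      (r * a) * c′ - (r * a′) * c     ≈⟨ +-cong (*-assoc r a c′) (-‿cong (*-assoc r a′ c)) ⟩
      r * (a * c′) - r * (a′ * c)     ≈⟨ +-congˡ (-‿distribʳ-* r (a′ * c)) ⟩
      r * (a * c′) + r * - (a′ * c)   ≈⟨ distribˡ r _ _ ⟨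
      r * (a * c′ - a′ * c)           ∎
      where open R

    det-self : ∀ a → det a a ≈ 0#
    det-self (a , a′) = trans (+-congˡ (-‿cong (*-comm a′ a))) (-‿inverseʳ (a * a′))

    det-flip : ∀ a b → det a b ≈ 0# → det b a ≈ 0#
    det-flip (a , a′) (b , b′) ab≈0 = begin
      b * a′ - b′ * a        ≈⟨ +-cong (*-comm b a′) (-‿cong (*-comm b′ a)) ⟩
      a′ * b - a * b′        ≈⟨ +-comm _ _ ⟩
      - (a * b′) + a′ * b    ≈⟨ +-congˡ (-‿involutive (a′ * b)) ⟨
      - (a * b′) - - (a′ * b) ≈⟨ -‿+-comm _ _ ⟩
      - (a * b′ - a′ * b)    ≈⟨ -‿cong ab≈0 ⟩
      - 0#                   ≈⟨ -0#≈0# ⟩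
      0#                     ∎
      where open R

    det-congˡ : ∀ {a b} c → a ≈ₚ b → det a c ≈ det b c
    det-congˡ c (p , q) = +-cong (*-congʳ p) (-‿cong (*-congʳ q))

    -- The part of Cramer's rule giving uniqueness of the intersection parameter.
    cramer : ∀ p q r q′ m {k i} → p +ₚ r ·ₚ q ≈ₚ q′ +ₚ k ·ₚ m → det q m * i ≈ 1# →
             r ≈ (det q′ m - det p m) * i
    cramer p q r q′ m {k} {i} eq inv = begin
      r                            ≈⟨ *-identityʳ r ⟨
      r * 1#                       ≈⟨ *-congˡ inv ⟨
      r * (det q m * i)            ≈⟨ *-assoc _ _ _ ⟨
      r * det q m * i              ≈⟨ *-congʳ lin ⟩
      (det q′ m - det p m) * i     ∎
      where
      open R
      sum : det p m + r * det q m ≈ det q′ m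
      sum = begin
        det p m + r * det q m        ≈⟨ +-congˡ (det-· r q m) ⟨
        det p m + det (r ·ₚ q) m     ≈⟨ det-+ p (r ·ₚ q) m ⟨
        det (p +ₚ r ·ₚ q) m          ≈⟨ det-congˡ m eq ⟩
        det (q′ +ₚ k ·ₚ m) m         ≈⟨ det-+ q′ (k ·ₚ m) m ⟩
        det q′ m + det (k ·ₚ m) m    ≈⟨ +-congˡ (det-· k m m) ⟩
        det q′ m + k * det m m       ≈⟨ +-congˡ (*-congˡ (det-self m)) ⟩
        det q′ m + k * 0#            ≈⟨ +-congˡ (zeroʳ k) ⟩
        det q′ m + 0#                ≈⟨ +-identityʳ _ ⟩
        det q′ m                     ∎
      lin : r * det q m ≈ det q′ m - det p m
      lin = begin
        r * det q m                        ≈⟨ +-identityʳ _ ⟨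
        r * det q m + 0#                   ≈⟨ +-congˡ (-‿inverseʳ (det p m)) ⟨
        r * det q m + (det p m - det p m)  ≈⟨ +-assoc _ _ _ ⟨
        (r * det q m + det p m) - det p m  ≈⟨ +-congʳ (trans (+-comm _ _) sum) ⟩
        det q′ m - det p m                 ∎

    ≉0⇐ : ∀ {a b} → ¬ Parallel a b → ¬ det a b ≈ 0#
    ≉0⇐ {a} {b} np eq with O.compare (det a b) 0#
    ... | tri< _ neq _ = neq eq
    ... | tri≈ _ _ _   = np _≡_.refl
    ... | tri> _ neq _ = neq eq

    ≤-dec : ∀ x y → Dec (x ≤ y)
    ≤-dec = StrictToNonStrict.decidable′ _≈_ _<_ O.compare

    ≤-respˡ : ∀ {x y z} → x ≈ y → x ≤ z → y ≤ z
    ≤-respˡ x≈y (inj₁ x<z) = inj₁ (O.<-respˡ-≈ x≈y x<z)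
    ≤-respˡ x≈y (inj₂ x≈z) = inj₂ (trans (sym x≈y) x≈z)

    ≤-respʳ : ∀ {x y z} → x ≈ y → z ≤ x → z ≤ y
    ≤-respʳ x≈y (inj₁ z<x) = inj₁ (O.<-respʳ-≈ x≈y z<x)
    ≤-respʳ x≈y (inj₂ z≈x) = inj₂ (trans z≈x x≈y)

    ≈ₚ-sym : ∀ {p q} → p ≈ₚ q → q ≈ₚ p
    ≈ₚ-sym (p , q) = sym p , sym q

    subst-eq : ∀ {t t′ r r′ b l U d} → t ≈ t′ → r ≈ r′ →
               b + t * l ≈ U + r * d → b + t′ * l ≈ U + r′ * d
    subst-eq p q e = trans (+-congˡ (*-congʳ (sym p))) (trans e (+-congˡ (*-congʳ q)))

  rayMeets? : ∀ b l U V → ¬ Parallel l (V -ₚ U) → Dec (RayMeets b l U V)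
  rayMeets? b l U V np
    with i , inv-t ← inverse (det l (V -ₚ U)) (≉0⇐ np)
       | j , inv-r ← inverse (det (V -ₚ U) l)
                       (λ z → ≉0⇐ np (det-flip (V -ₚ U) l z)) = decide
    where
    d = V -ₚ U
    t₀ = (det U d - det b d) * i
    r₀ = (det b l - det U l) * j

    decide : Dec (RayMeets b l U V)
    decide with 0# O.<? t₀ | ≤-dec 0# r₀ | ≤-dec r₀ 1#
              | O._≟_ (proj₁ (b +ₚ t₀ ·ₚ l)) (proj₁ (U +ₚ r₀ ·ₚ d))
              | O._≟_ (proj₂ (b +ₚ t₀ ·ₚ l)) (proj₂ (U +ₚ r₀ ·ₚ d))
    ... | yes 0<t | yes 0≤r | yes r≤1 | yes x | yes y =
          yes (t₀ , 0<t , r₀ , 0≤r , r≤1 , x , y)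
    ... | no ¬0<t | _ | _ | _ | _ = no λ (t , 0<t , r , _ , _ , eq) →
          ¬0<t (O.<-respʳ-≈ (cramer b l t U d eq inv-t) 0<t)
    ... | yes _ | no ¬0≤r | _ | _ | _ = no λ (t , _ , r , 0≤r , _ , eq) →
          ¬0≤r (≤-respʳ (cramer U d r b l (≈ₚ-sym eq) inv-r) 0≤r)
    ... | yes _ | yes _ | no ¬r≤1 | _ | _ = no λ (t , _ , r , _ , r≤1 , eq) →
          ¬r≤1 (≤-respˡ (cramer U d r b l (≈ₚ-sym eq) inv-r) r≤1)
    ... | yes _ | yes _ | yes _ | no ¬x | _ = no λ (t , _ , r , _ , _ , eq) →
          ¬x (subst-eq (cramer b l t U d eq inv-t)
                       (cramer U d r b l (≈ₚ-sym eq) inv-r) (proj₁ eq))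
    ... | yes _ | yes _ | yes _ | yes _ | no ¬y = no λ (t , _ , r , _ , _ , eq) →
          ¬y (subst-eq (cramer b l t U d eq inv-t)
                       (cramer U d r b l (≈ₚ-sym eq) inv-r) (proj₂ eq))

  ----------------------------------------------------------------------
  -- Edge vectors

  Weights : ∀ {n} → PlabicGraph n → Set
  Weights G = PlabicGraph.Edge G → ℝ⁺

  module _ {n} (G : PlabicGraph n) where
    open PlabicGraph G

    -- The convention t = 1 at boundary vertices.
    extend : (Internal → ℝ⁺) → Vertex → ℝ⁺
    extend t (inj₁ _) = 1⁺
    extend t (inj₂ u) = t u

    weightGauge : (Internal → ℝ⁺) → Weights G → Weights G
    weightGauge t w e = w e *⁺ extend t (src e) *⁺ extend t (tgt e) ⁻¹

    weightGaugeAt : Internal → ℝ⁺ → Weights G → Weights G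
    weightGaugeAt u tᵤ = weightGauge (λ v → if ⌊ v Fin.≟ u ⌋ then tᵤ else 1⁺)

  module _ {n} (G : PlabicGraph n) (𝔤 : GaugeDirection G) where
    open PlabicGraph G
    open GaugeDirection 𝔤

    -- A gauge ray is not parallel to e, hence meets it in at most one point.
    int : Edge → ℕ
    int e = length (filter (λ i → source? i ×-dec
                              rayMeets? (pos (inj₁ i)) 𝔩 (pos (src e)) (pos (tgt e))
                                        (not-parallel e))
                           (allFin n))

    wind : Edge → Edge → ℤ
    wind e f = if ⌊ s (dir e) 𝔩 ℤ.≟ σ ⌋ ∧ ⌊ s 𝔩 (dir f) ℤ.≟ σ ⌋ then σ else 0ℤ
      where σ = s (dir e) (dir f)

    EdgeVectors : Set
    EdgeVectors = Edge → Fin n → Carrier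

    basis : Fin n → Fin n → Carrier
    basis j i = if ⌊ j Fin.≟ i ⌋ then 1# else 0#

    -- (-1) to a negative power is rendered through the absolute value.
    outgoingSum : EdgeVectors → Edge → Fin n → Carrier
    outgoingSum E e i =
      foldr _+_ 0# (map (λ f → (- 1#) ^ ℤ.∣ wind e f ∣ * E f i) (outgoing (tgt e)))

    record IsSolution (w : Weights G) (E : EdgeVectors) : Set where
      field
        at-internal : ∀ e u → tgt e ≡ inj₂ u → ∀ i →
                      E e i ≈ (- 1#) ^ int e * (val (w e) * outgoingSum E e i)
        at-sink     : ∀ e j → tgt e ≡ inj₁ j → ∀ i →
                      E e i ≈ (- 1#) ^ int e * (val (w e) * basis j i)

    record IsEdgeVectors (w : Weights G) (E : EdgeVectors) : Set where
      field
        isSolution : IsSolution w E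
        unique     : ∀ F → IsSolution w F → ∀ e i → F e i ≈ E e i

{-# OPTIONS --safe #-}
-- A weight gauge transformation t multiplies E_e by t at the source of e: the
-- factor t_V⁻¹ in the new weight of e = (U,V) cancels the common factor t_V of
-- the vectors outgoing at V, and t_U is left.  The inverse transformation
-- carries solutions back, hence uniqueness.
module Submission where

open import Defs
import Algebra.Properties.CommutativeSemigroup as CommutativeSemigroupProperties
open import Data.Bool.Base using (Bool; if_then_else_; _∨_)
open import Data.Empty using (⊥-elim)
open import Data.Fin.Properties using (_≟_)
open import Data.List.Base using (List; []; _∷_; allFin; foldr; length; map)
open import Data.List.Membership.Propositional using (_∈_)
open import Data.List.Membership.Propositional.Properties using (∈-allFin; ∈-filter⁺)
open import Data.List.Relation.Unary.All using (All; []; _∷_)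
open import Data.List.Relation.Unary.All.Properties using (all-filter)
open import Data.List.Relation.Unary.Any using (here; there)
open import Data.Integer.Base using (∣_∣)
import Data.Nat.Base as ℕ
import Data.Nat.Properties as ℕ
open import Data.Product.Base using (_×_; _,_; proj₂)
open import Data.Sum.Base using (_⊎_; inj₁; inj₂; [_,_]′)
open import Function.Base using (_∘_)
open import Relation.Binary.PropositionalEquality.Core as ≡ using (_≡_; _≢_)
import Relation.Binary.Reasoning.Setoid as SetoidReasoning
open import Relation.Nullary using (yes; no; Reflects; ofʸ; ofⁿ)
open import Relation.Nullary.Decidable using (⌊_⌋)

-- Exhausting short lists by known members.

module _ {a} {A : Set a} {x y : A} where

  length-1⇒≡ : ∀ {xs} → length xs ≡ 1 → x ∈ xs → y ∈ xs → y ≡ x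
  length-1⇒≡ {_ ∷ []} _ (here ≡.refl) (here ≡.refl) = ≡.refl

  -- Distinct `x` and `y` cannot sit at the same position, so together they occupy both, and `z`
  -- shares its position with one of them.
  length-2⇒≡⊎≡ : ∀ {z} {xs} → length xs ≡ 2 → x ∈ xs → y ∈ xs → x ≢ y →
                 z ∈ xs → z ≡ x ⊎ z ≡ y
  length-2⇒≡⊎≡ {xs = _ ∷ _ ∷ []} _ (here p) (here q) x≢y _ = ⊥-elim (x≢y (≡.trans p (≡.sym q)))
  length-2⇒≡⊎≡ {xs = _ ∷ _ ∷ []} _ (there (here p)) (there (here q)) x≢y _ =
    ⊥-elim (x≢y (≡.trans p (≡.sym q)))
  length-2⇒≡⊎≡ {xs = _ ∷ _ ∷ []} _ (here p) (there _) _ (here r) = inj₁ (≡.trans r (≡.sym p))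
  length-2⇒≡⊎≡ {xs = _ ∷ _ ∷ []} _ (here _) (there (here q)) _ (there (here r)) =
    inj₂ (≡.trans r (≡.sym q))
  length-2⇒≡⊎≡ {xs = _ ∷ _ ∷ []} _ (there _) (here q) _ (here r) = inj₂ (≡.trans r (≡.sym q))
  length-2⇒≡⊎≡ {xs = _ ∷ _ ∷ []} _ (there (here p)) (here _) _ (there (here r)) =
    inj₁ (≡.trans r (≡.sym p))

-- Arithmetic of gauge factors.

module _ (ℝ : Reals) where
  open Plabic ℝ
  open CommutativeSemigroupProperties *-commutativeSemigroup
    using (x∙yz≈y∙xz; xy∙z≈xz∙y; xy∙z≈y∙xz)
  open SetoidReasoning setoid

  ⁻¹-inverseʳ : ∀ t → val t * val (t ⁻¹) ≈ 1#
  ⁻¹-inverseʳ t = proj₂ (inverse (val t) _)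

  ⁻¹-inverseˡ : ∀ t → val (t ⁻¹) * val t ≈ 1#
  ⁻¹-inverseˡ t = trans (*-comm _ _) (⁻¹-inverseʳ t)

  -- The inverse is an opaque witness of the field axiom, so this does not hold by computation,
  -- although boundary vertices carry the factor `1⁺`.
  1⁺⁻¹≈1 : val (1⁺ ⁻¹) ≈ 1#
  1⁺⁻¹≈1 = trans (sym (*-identityˡ _)) (⁻¹-inverseʳ 1⁺)

  cancel : ∀ {x y} z → x * y ≈ 1# → z * x * y ≈ z
  cancel z xy≈1 = trans (*-assoc _ _ _) (trans (*-congˡ xy≈1) (*-identityʳ z))

  -- The equation of a single edge: `g` is its sign, `x` the outgoing sum or basis vector, and `σ`,
  -- `τ` are the factors at its source and target.
  rescale : ∀ {w w′ σ τ} g x → w′ * τ ≈ w * σ →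
            σ * (g * (w * x)) ≈ g * (w′ * (τ * x))
  rescale {w} {w′} {σ} {τ} g x eq = begin
    σ * (g * (w * x))  ≈⟨ x∙yz≈y∙xz σ g _ ⟩
    g * (σ * (w * x))  ≈⟨ *-congˡ (xy∙z≈y∙xz w σ x) ⟨
    g * (w * σ * x)    ≈⟨ *-congˡ (*-congʳ eq) ⟨
    g * (w′ * τ * x)   ≈⟨ *-congˡ (*-assoc w′ τ x) ⟩
    g * (w′ * (τ * x)) ∎

  -- Edges and transformed weights around one vertex.

  module _ {n} (G : PlabicGraph n) where
    open PlabicGraph G

    outgoing⁺ : ∀ {e v} → src e ≡ v → e ∈ outgoing v
    outgoing⁺ {e} {v} = ∈-filter⁺ (λ e → src e ≟ᵥ v) (∈-allFin e)

    incoming⁺ : ∀ {e v} → tgt e ≡ v → e ∈ incoming v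
    incoming⁺ {e} {v} = ∈-filter⁺ (λ e → tgt e ≟ᵥ v) (∈-allFin e)

    outgoing-white : ∀ u → colour u ≡ white → degree (inj₂ u) ≡ 3 →
                     length (outgoing (inj₂ u)) ≡ 2
    outgoing-white u c d = ℕ.+-cancelʳ-≡ 1 _ 2
      (≡.trans (≡.cong (length (outgoing (inj₂ u)) ℕ.+_) (≡.sym (white-perfect u c))) d)

    incoming-black : ∀ v → colour v ≡ black → degree (inj₂ v) ≡ 3 →
                     length (incoming (inj₂ v)) ≡ 2
    incoming-black v c d = ℕ.+-cancelˡ-≡ 1 _ 2
      (≡.trans (≡.cong (ℕ._+ length (incoming (inj₂ v))) (≡.sym (black-perfect v c))) d)

    module _ (u : Internal) (t : ℝ⁺) where
      -- Names the function inside `weightGaugeAt`, which thus unfolds to `weightGauge` at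
      -- `gaugeAt`.
      gaugeAt : Internal → ℝ⁺
      gaugeAt v = if ⌊ v ≟ u ⌋ then t else 1⁺

      extend-at : ∀ {x} → x ≡ inj₂ u → extend G gaugeAt x ≡ t
      extend-at ≡.refl with u ≟ u
      ... | yes _  = ≡.refl
      ... | no u≢u = ⊥-elim (u≢u ≡.refl)

      extend-away : ∀ {x} → x ≢ inj₂ u → extend G gaugeAt x ≡ 1⁺
      extend-away {inj₁ _} _ = ≡.refl
      extend-away {inj₂ v} v≢u with v ≟ u
      ... | yes ≡.refl = ⊥-elim (v≢u ≡.refl)
      ... | no _       = ≡.refl

      module _ (w : Weights G) {e : Edge} where
        weight-outgoing : src e ≡ inj₂ u → val (weightGaugeAt G u t w e) ≈ val t * val (w e)
        weight-outgoing p
          -- Without loops the target of `e` differs from `u`, so its factor is `1⁺`.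
          rewrite extend-at p | extend-away (λ q → no-loops e (≡.trans p (≡.sym q))) =
          trans (*-congˡ 1⁺⁻¹≈1) (trans (*-identityʳ _) (*-comm _ _))

        weight-incoming : tgt e ≡ inj₂ u → val (weightGaugeAt G u t w e) ≈ val (t ⁻¹) * val (w e)
        weight-incoming q
          rewrite extend-at q | extend-away (λ p → no-loops e (≡.trans p (≡.sym q))) =
          trans (*-congʳ (*-identityʳ _)) (*-comm _ _)

        weight-away : src e ≢ inj₂ u → tgt e ≢ inj₂ u →
                      val (weightGaugeAt G u t w e) ≈ val (w e)
        weight-away p q rewrite extend-away p | extend-away q =
          trans (*-congˡ 1⁺⁻¹≈1) (trans (*-identityʳ _) (*-identityʳ _))

    -- Edge vectors under rescaling.

    module _ (𝔤 : GaugeDirection G) where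

      -- The winding signs depend on the geometry alone, so a factor common to all vectors leaving
      -- `tgt e` comes out of the sum.
      outgoingSum-scale : ∀ (E F : EdgeVectors G 𝔤) e c i →
                          (∀ f → src f ≡ tgt e → F f i ≈ c * E f i) →
                          outgoingSum G 𝔤 F e i ≈ c * outgoingSum G 𝔤 E e i
      outgoingSum-scale E F e c i F≈cE =
        go (outgoing (tgt e)) (all-filter (λ f → src f ≟ᵥ tgt e) (allFin edges))
        where
        total : EdgeVectors G 𝔤 → List Edge → Carrier
        total H = foldr _+_ 0# ∘ map (λ f → (- 1#) ^ ∣ wind G 𝔤 e f ∣ * H f i)

        go : ∀ fs → All (λ f → src f ≡ tgt e) fs → total F fs ≈ c * total E fs
        go [] [] = sym (zeroʳ c)
        go (f ∷ fs) (p ∷ ps) =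
          trans (+-cong (trans (*-congˡ (F≈cE f p)) (x∙yz≈y∙xz _ c _)) (go fs ps))
                (sym (distribˡ c _ _))

      isSolution-cong : ∀ {w} {E F : EdgeVectors G 𝔤} → (∀ e i → F e i ≈ E e i) →
                        IsSolution G 𝔤 w E → IsSolution G 𝔤 w F
      isSolution-cong {E = E} {F} F≈E sol = record
        { at-internal = λ e u p i → trans (F≈E e i) (trans (at-internal e u p i)
            (*-congˡ (*-congˡ (sym (trans
              -- With factor 1 the scaling lemma becomes congruence of the outgoing sum.
              (outgoingSum-scale E F e 1# i λ f _ → trans (F≈E f i) (sym (*-identityˡ _)))
              (*-identityˡ _))))))
        ; at-sink = λ e j p i → trans (F≈E e i) (at-sink e j p i)
        }
        where open IsSolution sol

      isEdgeVectors-cong : ∀ {w} {E F : EdgeVectors G 𝔤} → (∀ e i → F e i ≈ E e i) →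
                           IsEdgeVectors G 𝔤 w E → IsEdgeVectors G 𝔤 w F
      isEdgeVectors-cong F≈E ev = record
        { isSolution = isSolution-cong F≈E isSolution
        ; unique     = λ H sol e i → trans (unique H sol e i) (sym (F≈E e i))
        }
        where open IsEdgeVectors ev

      -- The intersection and winding signs do not involve weights, so compatibility along each edge
      -- suffices; `τ` is 1 on the boundary because the basis vectors at the sinks stay fixed.
      -- Keeping `τ` arbitrary lets the lemma serve for a gauge and for its inverse.
      isSolution-rescale : ∀ {w w′ : Weights G} {E} (τ : Vertex → Carrier) →
                           (∀ j → τ (inj₁ j) ≈ 1#) →
                           (∀ e → val (w′ e) * τ (tgt e) ≈ val (w e) * τ (src e)) →
                           IsSolution G 𝔤 w E →
                           IsSolution G 𝔤 w′ (λ e i → τ (src e) * E e i)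
      isSolution-rescale {E = E} τ τ≈1 w′τ≈wτ sol = record
        { at-internal = λ e u p i → trans (*-congˡ (at-internal e u p i))
            (trans (rescale _ _ (w′τ≈wτ e))
              (*-congˡ (*-congˡ (sym (outgoingSum-scale E (λ f k → τ (src f) * E f k) e (τ (tgt e)) i
                λ f q → *-congʳ (reflexive (≡.cong τ q)))))))
        ; at-sink = λ e j p i → trans (*-congˡ (at-sink e j p i))
            (trans (rescale _ _ (w′τ≈wτ e))
              (*-congˡ (*-congˡ (trans
                (*-congʳ (trans (reflexive (≡.cong τ p)) (τ≈1 j))) (*-identityˡ _)))))
        }
        where open IsSolution sol

      isEdgeVectors-weightGauge : ∀ {w E} (t : Internal → ℝ⁺) → IsEdgeVectors G 𝔤 w E →
                                  IsEdgeVectors G 𝔤 (weightGauge G t w)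
                                    (λ e i → val (extend G t (src e)) * E e i)
      isEdgeVectors-weightGauge {w} {E} t ev = record
        { isSolution = isSolution-rescale τ (λ _ → refl)
            (λ e → cancel _ (⁻¹-inverseˡ (extend G t (tgt e)))) isSolution
        -- Dividing `F` by the factors at the sources solves the original system, where uniqueness
        -- gives `E`; multiplying back recovers `F`.
        ; unique = λ F sol e i → begin
            F e i                              ≈⟨ *-identityˡ _ ⟨
            1# * F e i                         ≈⟨ *-congʳ (⁻¹-inverseʳ (extend G t (src e))) ⟨
            τ (src e) * τ⁻¹ (src e) * F e i    ≈⟨ *-assoc _ _ _ ⟩
            τ (src e) * (τ⁻¹ (src e) * F e i)  ≈⟨ *-congˡ (unique _ (back F sol) e i) ⟩
            τ (src e) * E e i                  ∎
        }
        where
        open IsEdgeVectors ev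
        τ τ⁻¹ : Vertex → Carrier
        τ v   = val (extend G t v)
        τ⁻¹ v = val (extend G t v ⁻¹)
        back : ∀ F → IsSolution G 𝔤 (weightGauge G t w) F →
               IsSolution G 𝔤 w (λ e i → τ⁻¹ (src e) * F e i)
        -- The two weights swap roles: in the gauged weight of `e` times `τ⁻¹ (src e)` the source
        -- factor cancels, leaving the old weight times `τ⁻¹ (tgt e)`.
        back F = isSolution-rescale τ⁻¹ (λ _ → 1⁺⁻¹≈1) λ e → sym (trans
          (xy∙z≈xz∙y _ _ _) (*-congʳ (cancel _ (⁻¹-inverseʳ (extend G t (src e))))))

      -- Only edges leaving `u` get a factor other than 1. The test `b` for these edges is a
      -- parameter, so that it can be phrased through two edges at a white vertex and through one at
      -- a black vertex.
      isEdgeVectors-weightGaugeAt :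
        ∀ {w E} u t (b : Edge → Bool) → (∀ e → Reflects (src e ≡ inj₂ u) (b e)) →
        IsEdgeVectors G 𝔤 w E →
        IsEdgeVectors G 𝔤 (weightGaugeAt G u t w)
          (λ e i → if b e then val t * E e i else E e i)
      isEdgeVectors-weightGaugeAt {E = E} u t b refl-b ev =
        isEdgeVectors-cong pointwise (isEdgeVectors-weightGauge (gaugeAt u t) ev)
        where
        pointwise : ∀ e i → (if b e then val t * E e i else E e i) ≈
                            val (extend G (gaugeAt u t) (src e)) * E e i
        pointwise e i with b e | refl-b e
        ... | _ | ofʸ p rewrite extend-at u t p   = refl
        ... | _ | ofⁿ p rewrite extend-away u t p = sym (*-identityˡ _)

lemma4p10 : (ℝ : Reals) → let open Plabic ℝ in
    ∀ {n} (G : PlabicGraph n) → let open PlabicGraph G in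
    (𝔤 : GaugeDirection G) (w : Weights G) (E : EdgeVectors G 𝔤) →
    IsEdgeVectors G 𝔤 w E →
    ( ∀ (u : Internal) (e₁ e₂ e₃ : Edge) (tᵤ : ℝ⁺) →
    colour u ≡ white → degree (inj₂ u) ≡ 3 →
    tgt e₃ ≡ inj₂ u → src e₁ ≡ inj₂ u → src e₂ ≡ inj₂ u → e₁ ≢ e₂ →
    let w̃ = weightGaugeAt G u tᵤ w in
    ( val (w̃ e₁) ≈ val tᵤ * val (w e₁) ×
    val (w̃ e₂) ≈ val tᵤ * val (w e₂) ×
    val (w̃ e₃) ≈ val (tᵤ ⁻¹) * val (w e₃) ×
    (∀ e → e ≢ e₁ → e ≢ e₂ → e ≢ e₃ → val (w̃ e) ≈ val (w e)) ) ×
    IsEdgeVectors G 𝔤 w̃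
    (λ e i → if ⌊ e ≟ e₁ ⌋ ∨ ⌊ e ≟ e₂ ⌋ then val tᵤ * E e i else E e i) ) ×
    ( ∀ (v : Internal) (e₁ e₂ e₃ : Edge) (tᵥ : ℝ⁺) →
    colour v ≡ black → degree (inj₂ v) ≡ 3 →
    tgt e₂ ≡ inj₂ v → tgt e₃ ≡ inj₂ v → e₂ ≢ e₃ → src e₁ ≡ inj₂ v →
    let w̃ = weightGaugeAt G v tᵥ w in
    ( val (w̃ e₁) ≈ val tᵥ * val (w e₁) ×
    val (w̃ e₂) ≈ val (tᵥ ⁻¹) * val (w e₂) ×
    val (w̃ e₃) ≈ val (tᵥ ⁻¹) * val (w e₃) ×
    (∀ e → e ≢ e₁ → e ≢ e₂ → e ≢ e₃ → val (w̃ e) ≈ val (w e)) ) ×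
    IsEdgeVectors G 𝔤 w̃
    (λ e i → if ⌊ e ≟ e₁ ⌋ then val tᵥ * E e i else E e i) )
lemma4p10 ℝ G 𝔤 w E ev = at-white , at-black
  where
  open Plabic ℝ
  open PlabicGraph G

  at-white : _
  at-white u e₁ e₂ e₃ t c d tgt₃ src₁ src₂ e₁≢e₂ =
    ( weight-outgoing ℝ G u t w src₁
    , weight-outgoing ℝ G u t w src₂
    , weight-incoming ℝ G u t w tgt₃
    , λ e ≢₁ ≢₂ ≢₃ → weight-away ℝ G u t w (src≢ ≢₁ ≢₂) (≢₃ ∘ only-incoming) )
    , isEdgeVectors-weightGaugeAt ℝ G 𝔤 u t _ reflects ev
    where
    -- Degree 3 minus the single incoming edge of a white vertex leaves two outgoing edges, which
    -- must be the distinct `e₁` and `e₂`.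
    only-outgoing : ∀ {e} → src e ≡ inj₂ u → e ≡ e₁ ⊎ e ≡ e₂
    only-outgoing p = length-2⇒≡⊎≡ (outgoing-white ℝ G u c d)
      (outgoing⁺ ℝ G src₁) (outgoing⁺ ℝ G src₂) e₁≢e₂ (outgoing⁺ ℝ G p)

    only-incoming : ∀ {e} → tgt e ≡ inj₂ u → e ≡ e₃
    only-incoming p = length-1⇒≡ (white-perfect u c) (incoming⁺ ℝ G tgt₃) (incoming⁺ ℝ G p)

    src≢ : ∀ {e} → e ≢ e₁ → e ≢ e₂ → src e ≢ inj₂ u
    src≢ ≢₁ ≢₂ = [ ≢₁ , ≢₂ ]′ ∘ only-outgoing

    -- The edges leaving `u` are exactly `e₁` and `e₂`, so the general source factor takes the
    -- stated form.
    reflects : ∀ e → Reflects (src e ≡ inj₂ u) (⌊ e ≟ e₁ ⌋ ∨ ⌊ e ≟ e₂ ⌋)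
    reflects e with e ≟ e₁ | e ≟ e₂
    ... | yes ≡.refl | _          = ofʸ src₁
    ... | no _       | yes ≡.refl = ofʸ src₂
    ... | no ≢₁      | no ≢₂      = ofⁿ (src≢ ≢₁ ≢₂)

  at-black : _
  at-black v e₁ e₂ e₃ t c d tgt₂ tgt₃ e₂≢e₃ src₁ =
    ( weight-outgoing ℝ G v t w src₁
    , weight-incoming ℝ G v t w tgt₂
    , weight-incoming ℝ G v t w tgt₃
    , λ e ≢₁ ≢₂ ≢₃ → weight-away ℝ G v t w (≢₁ ∘ only-outgoing) ([ ≢₂ , ≢₃ ]′ ∘ only-incoming) )
    , isEdgeVectors-weightGaugeAt ℝ G 𝔤 v t _ reflects ev
    where
    -- Dually, perfectness makes `e₁` the only edge leaving a black vertex, hence the only one whose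
    -- vector is rescaled.
    only-outgoing : ∀ {e} → src e ≡ inj₂ v → e ≡ e₁
    only-outgoing p = length-1⇒≡ (black-perfect v c) (outgoing⁺ ℝ G src₁) (outgoing⁺ ℝ G p)

    only-incoming : ∀ {e} → tgt e ≡ inj₂ v → e ≡ e₂ ⊎ e ≡ e₃
    only-incoming p = length-2⇒≡⊎≡ (incoming-black ℝ G v c d)
      (incoming⁺ ℝ G tgt₂) (incoming⁺ ℝ G tgt₃) e₂≢e₃ (incoming⁺ ℝ G p)

    reflects : ∀ e → Reflects (src e ≡ inj₂ v) ⌊ e ≟ e₁ ⌋
    reflects e with e ≟ e₁
    ... | yes ≡.refl = ofʸ src₁
    ... | no ≢₁      = ofⁿ (≢₁ ∘ only-outgoing)
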